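{- Let $G$ be a finite simple graph with $\mathrm{mad}(G)\le 3$. Then $\chi^t_{\mathrm M}(G)\le 2$; that is, there is a map $\ell: V(G)\cup E(G)\to\{1,2\}$ such that for every edge $uv$ of $G$ we have $\mu_\ell(u)\neq\mu_\ell(v)$, where $\mu_\ell(w)$ is the multiset consisting of $\ell(w)$ together with $\ell(wx)$ for all $x\in N(w)$.
   Context: A total $k$-labelling of a graph $G$ is a map $\ell: V(G)\cup E(G)\to\{1,\dots,k\}$. For a vertex $w$, $\mu_\ell(w)$ is the multiset of labels consisting of the label of $w$ and the labels of all edges incident to $w$. The labelling is multiset-proper if $\mu_\ell(u)\ne\mu_\ell(v)$ for every edge $uv$. $\chi^t_{\mathrm M}(G)$ is the smallest $k\ge1$ such that $G$ admits a multiset-proper total $k$-labelling. The average degree of a graph $H$ is $2|E(H)|/|V(H)|$, and the maximum average degree $\mathrm{mad}(G)$ is the maximum of the average degree over all (not necessarily induced) nonempty subgraphs $H$ of $G$. -}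

module Defs where

open import Data.Nat using (ℕ; zero; suc; _+_; _*_; _≤_; _<ᵇ_)
open import Data.Bool using (Bool; true; false; _∧_; if_then_else_)
open import Data.Fin using (Fin; zero; suc; toℕ; _≟_)
open import Data.Product using (_×_; Σ; ∃)
open import Relation.Binary.PropositionalEquality using (_≡_)
open import Relation.Nullary using (¬_)
open import Relation.Nullary.Decidable using (⌊_⌋)

count : ∀ {n} → (Fin n → Bool) → ℕ
count {zero}  p = 0
count {suc n} p = (if p zero then 1 else 0) + count (λ i → p (suc i))

record Graph (n : ℕ) : Set where
  field
    Adj     : Fin n → Fin n → Bool
    symm    : ∀ i j → Adj i j ≡ Adj j i
    irrefl  : ∀ i → Adj i i ≡ false
open Graph public

record Subgraph {n : ℕ} (G : Graph n) : Set where
  field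
    S       : Fin n → Bool
    F       : Fin n → Fin n → Bool
    F-symm  : ∀ i j → F i j ≡ F j i
    F⊆E     : ∀ i j → F i j ≡ true → Adj G i j ≡ true
    F-endsS : ∀ i j → F i j ≡ true → S i ≡ true
open Subgraph public

vcount : ∀ {n} {G : Graph n} → Subgraph G → ℕ
vcount H = count (S H)

ecount : ∀ {n} {G : Graph n} → Subgraph G → ℕ
ecount {n} H = sumF (λ i → count (λ j → (toℕ i <ᵇ toℕ j) ∧ F H i j))
  where
  sumF : ∀ {m} → (Fin m → ℕ) → ℕ
  sumF {zero} f = 0
  sumF {suc m} f = f zero + sumF (λ i → f (suc i))

Nonempty : ∀ {n} {G : Graph n} → Subgraph G → Set
Nonempty H = ∃ λ v → S H v ≡ true

-- mad(G) ≤ 3  ⇔  every nonempty subgraph H has 2|E(H)|/|V(H)| ≤ 3,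
-- i.e. 2|E(H)| ≤ 3|V(H)| (|V(H)| > 0)
mad≤3 : ∀ {n} → Graph n → Set
mad≤3 G = ∀ (H : Subgraph G) → Nonempty H → 2 * ecount H ≤ 3 * vcount H

-- total k-labelling: label set {1,…,k} represented by Fin k (c ↦ toℕ c + 1);
-- edge labels given by a symmetric function (edge uv gets el u v = el v u)
record TotalLabelling {n : ℕ} (G : Graph n) (k : ℕ) : Set where
  field
    vl      : Fin n → Fin k
    el      : Fin n → Fin n → Fin k
    el-symm : ∀ i j → el i j ≡ el j i
open TotalLabelling public

-- μ_ℓ(w) as a multiset over the labels, given by its multiplicity function:
-- multiplicity of c = [ℓ(w) = c] + #{x ∈ N(w) : ℓ(wx) = c}
μ : ∀ {n k} {G : Graph n} → TotalLabelling G k → Fin n → Fin k → ℕ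
μ {G = G} ℓ w c =
  (if ⌊ vl ℓ w ≟ c ⌋ then 1 else 0) + count (λ x → Adj G w x ∧ ⌊ el ℓ w x ≟ c ⌋)

-- multisets are equal iff their multiplicity functions agree
MultisetProper : ∀ {n k} {G : Graph n} → TotalLabelling G k → Set
MultisetProper {n} {k} {G} ℓ =
  ∀ (u v : Fin n) → Adj G u v ≡ true → ¬ (∀ (c : Fin k) → μ ℓ u c ≡ μ ℓ v c)

{-# OPTIONS --safe #-}

-- Write 0/1 for the labels. Adjacent vertices get different multisets as soon as their numbers of
-- ones differ. Repeatedly remove vertices with at most two remaining neighbours; by mad(G) ≤ 3 and the
-- handshake lemma, what is left is cubic. Take a maximal independent set 𝕀 of the cubic part, where
-- the other vertices then span a graph of maximum degree 2, and re-insert the removed vertices, in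
-- 𝕀 if possible. The vertices outside 𝕀 are split into 𝔼 and 𝕆 ∪ 𝕏, with 𝔼 independent and with
-- the edges inside 𝕆 ∪ 𝕏 forming a matching between 𝕏 and 𝕆. Edges at 𝕀 get 0, and nearly all others get
-- 1; vertex labels then make the number of ones 0 on 𝕀, positive and even on 𝔼, odd on 𝕆 ∪ 𝕏. The
-- conflict on a matching edge xy is resolved by the labels of xy and of one edge from x to 𝔼.
module Submission where

open import Defs
open import Data.Bool using (Bool; true; false; _∧_; _∨_; not; if_then_else_)
open import Data.Bool.Properties as Bool using (∧-zeroʳ; ∧-identityʳ; ∨-comm; ∨-identityʳ)
open import Data.Empty using (⊥; ⊥-elim)
open import Data.Fin using (Fin; zero; suc; _≟_)
open import Data.Fin.Properties as Fin using (any?)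
open import Data.List using (List; []; _∷_; allFin)
open import Data.List.Membership.Propositional using (_∈_)
open import Data.List.Membership.Propositional.Properties using (∈-allFin)
open import Data.List.Relation.Unary.Any using (here; there)
open import Data.Nat using (ℕ; zero; suc; _+_; _*_; _≤_; z≤n; s≤s; _≤?_)
open import Data.Nat.Properties as ℕ using (+-0-commutativeMonoid; +-commutativeSemigroup; ≤-refl; ≤-trans; +-mono-≤; +-cancelˡ-≤; +-cancelʳ-≤; +-monoˡ-≤; +-monoʳ-≤; +-identityʳ; +-assoc; *-distribˡ-+; *-zeroʳ; ≰⇒>; 1+n≢n)
open import Algebra.Properties.CommutativeMonoid.Sum +-0-commutativeMonoid using (sum; sum-cong-≗; ∑-distrib-+)
open import Algebra.Properties.CommutativeSemigroup +-commutativeSemigroup using (x∙yz≈y∙xz)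
open import Data.Product using (Σ; ∃; ∃₂; _×_; _,_; proj₁; proj₂)
open import Data.Sum as Sum using (_⊎_; inj₁; inj₂)
open import Data.Unit using (⊤; tt)
open import Data.Vec.Functional using (updateAt)
open import Data.Vec.Functional.Properties using (updateAt-updates; updateAt-minimal)
open import Function using (_∘_; const; case_of_)
open import Relation.Nullary using (¬_; Dec; yes; no; contradiction)
open import Relation.Nullary.Decidable using (⌊_⌋; _×-dec_; _⊎-dec_)
open import Relation.Binary.PropositionalEquality

open ≡-Reasoning

-- Counting

bit : Bool → ℕ
bit b = if b then 1 else 0

count-cong : ∀ {n} {p q : Fin n → Bool} → p ≗ q → count p ≡ count q
count-cong {zero}  p≗q = refl
count-cong {suc n} p≗q = cong₂ _+_ (cong bit (p≗q zero)) (count-cong (p≗q ∘ suc))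

count-at : ∀ {n} {p q : Fin n → Bool} i → q i ≡ false →
  (∀ j → j ≢ i → p j ≡ q j) → count p ≡ bit (p i) + count q
count-at {p = p} zero qi p≗q rewrite qi =
  cong (bit (p zero) +_) (count-cong λ j → p≗q (suc j) λ ())
count-at {p = p} {q} (suc i) qi p≗q = begin
  bit (p zero) + count (p ∘ suc)
    ≡⟨ cong₂ _+_ (cong bit (p≗q zero λ ()))
         (count-at i qi λ j j≢i → p≗q (suc j) (j≢i ∘ Fin.suc-injective)) ⟩
  bit (q zero) + (bit (p (suc i)) + count (q ∘ suc))
    ≡⟨ x∙yz≈y∙xz (bit (q zero)) (bit (p (suc i))) (count (q ∘ suc)) ⟩
  bit (p (suc i)) + (bit (q zero) + count (q ∘ suc)) ∎

count-false : ∀ {n} {p : Fin n → Bool} → (∀ i → p i ≡ false) → count p ≡ 0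
count-false {zero}  p-false = refl
count-false {suc n} p-false rewrite p-false zero = count-false (p-false ∘ suc)

≟-refl : ∀ {n} (i : Fin n) → ⌊ i ≟ i ⌋ ≡ true
≟-refl i with i ≟ i
... | yes _  = refl
... | no i≢i = contradiction refl i≢i

≟-≢ : ∀ {n} {i j : Fin n} → i ≢ j → ⌊ i ≟ j ⌋ ≡ false
≟-≢ {i = i} {j} i≢j with i ≟ j
... | yes i≡j = contradiction i≡j i≢j
... | no _    = refl

_∖_ : ∀ {n} → (Fin n → Bool) → Fin n → Fin n → Bool
(p ∖ i) j = p j ∧ not ⌊ j ≟ i ⌋

∖-≢ : ∀ {n} (p : Fin n → Bool) {i j} → j ≢ i → p j ≡ (p ∖ i) j
∖-≢ p {i} {j} j≢i rewrite ≟-≢ j≢i = sym (∧-identityʳ (p j))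

∖-self : ∀ {n} (p : Fin n → Bool) i → (p ∖ i) i ≡ false
∖-self p i rewrite ≟-refl i = ∧-zeroʳ (p i)

count-∖ : ∀ {n} (p : Fin n → Bool) {i} → p i ≡ true → count p ≡ suc (count (p ∖ i))
count-∖ p {i} pi = trans (count-at i (∖-self p i) (λ _ → ∖-≢ p))
  (cong (λ b → bit b + count (p ∖ i)) pi)

-- Cardinality is bounded by the impossibility of naming `k + 1` distinct elements of `P` one after
-- another. A bound on neighbours is thus refuted by listing the neighbours with proofs that each
-- differs from the earlier ones.
AtMost : {A : Set} → ℕ → (A → Set) → Set
AtMost zero    P = ∀ x → ¬ P x
AtMost (suc k) P = ∀ x → P x → AtMost k (λ y → P y × y ≢ x)

AtMost-⊆ : {A : Set} {P Q : A → Set} (k : ℕ) → (∀ {x} → Q x → P x) → AtMost k P → AtMost k Q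
AtMost-⊆ zero    Q⊆P few x Qx = few x (Q⊆P Qx)
AtMost-⊆ (suc k) Q⊆P few x Qx = AtMost-⊆ k (λ { (Qy , y≢x) → Q⊆P Qy , y≢x }) (few x (Q⊆P Qx))

count⇒AtMost : ∀ {n} k {p : Fin n → Bool} → count p ≤ k → AtMost k (λ i → p i ≡ true)
count⇒AtMost zero    {p} p≤k i pi with () ← subst (_≤ 0) (count-∖ p pi) p≤k
count⇒AtMost (suc k) {p} p≤k i pi with s≤s le ← subst (_≤ suc k) (count-∖ p pi) p≤k =
  AtMost-⊆ k (λ { (pj , j≢i) → trans (sym (∖-≢ p j≢i)) pj }) (count⇒AtMost k le)

count≡sum : ∀ {n} (p : Fin n → Bool) → count p ≡ sum (bit ∘ p)
count≡sum {zero}  p = refl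
count≡sum {suc n} p = cong (bit (p zero) +_) (count≡sum (p ∘ suc))

sum-mono-≤ : ∀ {n} {f g : Fin n → ℕ} → (∀ i → f i ≤ g i) → sum f ≤ sum g
sum-mono-≤ {zero}  f≤g = z≤n
sum-mono-≤ {suc n} f≤g = +-mono-≤ (f≤g zero) (sum-mono-≤ (f≤g ∘ suc))

sum-*ˡ : ∀ {n} k (f : Fin n → ℕ) → k * sum f ≡ sum (λ i → k * f i)
sum-*ˡ {zero}  k f = *-zeroʳ k
sum-*ˡ {suc n} k f = trans (*-distribˡ-+ k (f zero) _) (cong (k * f zero +_) (sum-*ˡ k (f ∘ suc)))

-- An excess of `g` over `f` at one index cannot be compensated at another.
sum-squeeze : ∀ {n} {f g : Fin n → ℕ} → (∀ i → f i ≤ g i) → sum g ≤ sum f → ∀ i → g i ≤ f i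
sum-squeeze {suc n} {f} {g} f≤g Σg≤Σf zero    = +-cancelʳ-≤ (sum (f ∘ suc)) (g zero) (f zero)
  (≤-trans (+-monoʳ-≤ (g zero) (sum-mono-≤ (f≤g ∘ suc))) Σg≤Σf)
sum-squeeze {suc n} {f} {g} f≤g Σg≤Σf (suc i) = sum-squeeze (f≤g ∘ suc)
  (+-cancelˡ-≤ (f zero) _ _ (≤-trans (+-monoˡ-≤ _ (f≤g zero)) Σg≤Σf)) i

-- Parity

even? : ℕ → Bool
even? zero    = true
even? (suc m) = not (even? m)

-- A vertex label adds 0 or 1 to the number `m` of incident edges labelled 1, which suffices to
-- reach either parity.
roundOdd roundEven : ℕ → ℕ
roundOdd m  = bit (even? m) + m
roundEven m = bit (not (even? m)) + m

roundOdd-odd : ∀ m → even? (roundOdd m) ≡ false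
roundOdd-odd m with even? m in m-parity
... | true  = cong not m-parity
... | false = m-parity

roundEven-even : ∀ m → even? (roundEven m) ≡ true
roundEven-even m with even? m in m-parity
... | true  = m-parity
... | false = cong not m-parity

shift-≢ : ∀ m k → ∃ λ b → bit b + m ≢ k
shift-≢ m k with m ℕ.≟ k
... | no  m≢k  = false , m≢k
... | yes refl = true , 1+n≢n

-- The roundings of `m` and `suc m` are `suc m` twice, or `m` and `m + 2`. Together they therefore
-- determine `m`.
roundOdd-suc : ∀ m → roundOdd m + roundOdd (suc m) ≡ 2 * suc m
roundOdd-suc m with even? m
... | true  = cong (suc m +_) (sym (+-identityʳ (suc m)))
... | false = trans (ℕ.+-suc m (suc m)) (cong (suc m +_) (sym (+-identityʳ (suc m))))

-- If the roundings agreed both before and after adding 1, their sums would agree too, and by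
-- `roundOdd-suc` so would `m` and `k`.
shift-roundOdd : ∀ {m k} → m ≢ k → ∃ λ b → roundOdd (bit b + m) ≢ roundOdd (bit b + k)
shift-roundOdd {m} {k} m≢k with roundOdd m ℕ.≟ roundOdd k
... | no  ≢k = false , ≢k
... | yes ≡k = true , λ ≡1+k → m≢k (ℕ.suc-injective (ℕ.*-cancelˡ-≡ (suc m) (suc k) 2
  (trans (sym (roundOdd-suc m)) (trans (cong₂ _+_ ≡k ≡1+k) (roundOdd-suc k)))))

-- The 3-core

tailGraph : ∀ {n} → Graph (suc n) → Graph n
tailGraph G = record
  { Adj    = λ i j → Adj G (suc i) (suc j)
  ; symm   = λ i j → symm G (suc i) (suc j)
  ; irrefl = λ i → irrefl G (suc i)
  }

tailSubgraph : ∀ {n} {G : Graph (suc n)} → Subgraph G → Subgraph (tailGraph G)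
tailSubgraph H = record
  { S       = λ i → S H (suc i)
  ; F       = λ i j → F H (suc i) (suc j)
  ; F-symm  = λ i j → F-symm H (suc i) (suc j)
  ; F⊆E     = λ i j → F⊆E H (suc i) (suc j)
  ; F-endsS = λ i j → F-endsS H (suc i) (suc j)
  }

F-irrefl : ∀ {n} {G : Graph n} (H : Subgraph G) i → F H i i ≡ false
F-irrefl {G = G} H i with F H i i in Fii
... | false = refl
... | true  with () ← trans (sym (irrefl G i)) (F⊆E H i i Fii)

-- Induction on the vertices: an edge at vertex zero is counted once in row zero and, by symmetry,
-- once in column zero, which is spread over the remaining rows.
handshake : ∀ {n} {G : Graph n} (H : Subgraph G) → 2 * ecount H ≡ sum (λ i → count (F H i))
handshake {zero}      H = refl
handshake {suc n} {G} H = begin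
  2 * (d₀ + ecount H′)           ≡⟨ *-distribˡ-+ 2 d₀ _ ⟩
  2 * d₀ + 2 * ecount H′         ≡⟨ cong₂ (λ a b → d₀ + a + b) (+-identityʳ d₀) (handshake H′) ⟩
  d₀ + d₀ + sum degs             ≡⟨ +-assoc d₀ d₀ _ ⟩
  d₀ + (d₀ + sum degs)
    ≡⟨ cong₂ (λ a b → a + (b + sum degs))
         (cong (λ b → bit b + d₀) (sym (F-irrefl H zero)))
         (trans (count≡sum (λ i → F H zero (suc i))) (sum-cong-≗ λ i → cong bit (F-symm H zero (suc i)))) ⟩
  count (F H zero) + (sum (λ i → bit (F H (suc i) zero)) + sum degs)
    ≡⟨ cong (count (F H zero) +_) (sym (∑-distrib-+ (λ i → bit (F H (suc i) zero)) degs)) ⟩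
  sum (λ i → count (F H i))      ∎
  where
  H′ = tailSubgraph H
  d₀ = count (λ j → F H zero (suc j))
  degs = λ i → count (F H′ i)

deg : ∀ {n} → Graph n → (Fin n → Bool) → Fin n → ℕ
deg G S v = count (λ u → Adj G v u ∧ S u)

∧-trueˡ : ∀ {a b} → a ∧ b ≡ true → a ≡ true
∧-trueˡ {true} _ = refl

induced : ∀ {n} (G : Graph n) (S : Fin n → Bool) → Subgraph G
induced G S = record
  { S       = S
  ; F       = λ i j → S i ∧ (Adj G i j ∧ S j)
  ; F-symm  = F-symmetric
  ; F⊆E     = F⊆Adj
  ; F-endsS = λ _ _ → ∧-trueˡ
  }
  where
  F-symmetric : ∀ i j → S i ∧ (Adj G i j ∧ S j) ≡ S j ∧ (Adj G j i ∧ S i)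
  F-symmetric i j rewrite symm G i j with S i | S j
  ... | true  | true  = refl
  ... | true  | false = ∧-zeroʳ _
  ... | false | true  = sym (∧-zeroʳ _)
  ... | false | false = refl
  F⊆Adj : ∀ i j → S i ∧ (Adj G i j ∧ S j) ≡ true → Adj G i j ≡ true
  F⊆Adj i j Fij with true ← S i = ∧-trueˡ Fij

-- By `handshake`, the density bound for the induced subgraph says that the degrees within `S` sum
-- to at most 3 per vertex of `S`. With 3 as a lower bound everywhere, no degree can be larger.
core-cubic : ∀ {n} (G : Graph n) → mad≤3 G → (S : Fin n → Bool) →
  (∀ v → S v ≡ true → 3 ≤ deg G S v) → ∀ v → S v ≡ true → deg G S v ≤ 3
core-cubic G mad S 3≤deg v Sv = subst₂ _≤_ row (cong (λ b → 3 * bit b) Sv)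
  (sum-squeeze below (subst₂ _≤_ (handshake H) total (mad H (v , Sv))) v)
  where
  H = induced G S
  total : 3 * count S ≡ sum (λ i → 3 * bit (S i))
  total = trans (cong (3 *_) (count≡sum S)) (sum-*ˡ 3 (bit ∘ S))
  row : count (F H v) ≡ deg G S v
  row rewrite Sv = refl
  below : ∀ i → 3 * bit (S i) ≤ count (F H i)
  below i with S i in Si
  ... | true  = 3≤deg i Si
  ... | false = z≤n

-- Good colourings

-- none marks a vertex that has not been coloured yet.
Colour : Set
Colour = Fin 5

pattern none = zero
pattern 𝕀 = suc zero
pattern 𝔼 = suc (suc zero)
pattern 𝕆 = suc (suc (suc zero))
pattern 𝕏 = suc (suc (suc (suc zero)))

-- Reads a colour off the number of ones at a vertex. Both 𝕆 and 𝕏 have odd numbers and are read as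
-- 𝕆.
class : ℕ → Colour
class zero    = 𝕀
class (suc m) = if even? (suc m) then 𝔼 else 𝕆

class-odd : ∀ m → even? m ≡ false → class m ≡ 𝕆
class-odd (suc m) odd rewrite odd = refl

class-even : ∀ m → even? m ≡ true → m ≢ 0 → class m ≡ 𝔼
class-even zero    _    m≢0 = contradiction refl m≢0
class-even (suc m) even _ rewrite even = refl

fromBool : Bool → Fin 2
fromBool b = if b then suc zero else zero

≟-fromBool : ∀ b → ⌊ fromBool b ≟ suc zero ⌋ ≡ b
≟-fromBool true  = refl
≟-fromBool false = refl

module _ {n : ℕ} (G : Graph n) where

  infix 4 _~_ _~?_

  _~_ : Fin n → Fin n → Set
  u ~ v = Adj G u v ≡ true

  _~?_ : ∀ u v → Dec (u ~ v)
  u ~? v = Adj G u v Bool.≟ true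

  ~-sym : ∀ {u v} → u ~ v → v ~ u
  ~-sym {u} {v} = trans (symm G v u)

  ~-irrefl : ∀ {v} → ¬ v ~ v
  ~-irrefl {v} v~v with () ← trans (sym (irrefl G v)) v~v

  -- The edge from x ∈ 𝕏 to t x ∈ 𝔼 is the one whose label may be lowered to 0; support leaves every
  -- vertex of 𝔼 another edge labelled 1.
  record Good (c : Fin n → Colour) (t : Fin n → Fin n) : Set where
    field
      -- Uncoloured vertices may be adjacent, so that partial colourings can be good.
      proper         : ∀ {u v} → u ~ v → c u ≡ c v → c u ≡ none
      partner        : ∀ {x} → c x ≡ 𝕏 → ∃ λ y → x ~ y × c y ≡ 𝕆
      partner-unique : ∀ {x y y′} → c x ≡ 𝕏 → x ~ y → c y ≡ 𝕆 → x ~ y′ → c y′ ≡ 𝕆 → y ≡ y′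
      source-unique  : ∀ {y x x′} → c y ≡ 𝕆 → y ~ x → c x ≡ 𝕏 → y ~ x′ → c x′ ≡ 𝕏 → x ≡ x′
      target         : ∀ {x} → c x ≡ 𝕏 → x ~ t x × c (t x) ≡ 𝔼
      support        : ∀ {w} → c w ≡ 𝔼 → ∃ λ u → w ~ u × (c u ≡ 𝕆 ⊎ (c u ≡ 𝕏 × t u ≢ w))

  open Good

  -- Extending a good colouring by one vertex

  apart : {c : Fin n → Colour} {u v : Fin n} {a b : Colour} → c u ≡ a → c v ≡ b → a ≢ b → u ≢ v
  apart cu cv a≢b refl = a≢b (trans (sym cu) cv)

  -- What an uncoloured `v` needs in order to receive the colour, apart from having no neighbour of
  -- that colour. A vertex of 𝔼 needs a support, a vertex of 𝕆 must not become a second partner of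
  -- an 𝕏-vertex, and a vertex of 𝕏 needs its target `s` and a single 𝕆-neighbour that is still
  -- unmatched.
  Admissible : (Fin n → Colour) → Fin n → Fin n → Colour → Set
  Admissible c v s none = ⊥
  Admissible c v s 𝕀 = ⊤
  Admissible c v s 𝔼 = ∃ λ u → v ~ u × (c u ≡ 𝕆 ⊎ c u ≡ 𝕏)
  Admissible c v s 𝕆 = ∀ {x} → v ~ x → c x ≢ 𝕏
  Admissible c v s 𝕏 = (v ~ s × c s ≡ 𝔼) ×
    ∃ λ y → v ~ y × c y ≡ 𝕆 × (∀ {y′} → v ~ y′ → c y′ ≡ 𝕆 → y′ ≡ y) × (∀ {x} → y ~ x → c x ≢ 𝕏)

  module _ {c : Fin n → Colour} {t : Fin n → Fin n} {v : Fin n} (k : Colour) (s : Fin n)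
           (good : Good c t) (cv : c v ≡ none)
           (admissible : Admissible c v s k) (fresh : ∀ {u} → v ~ u → c u ≢ k) where

    private
      c′ : Fin n → Colour
      c′ = updateAt c v (const k)

      t′ : Fin n → Fin n
      t′ = updateAt t v (const s)

      view : ∀ u {m} → c′ u ≡ m → (u ≡ v × k ≡ m) ⊎ (u ≢ v × c u ≡ m)
      view u c′u with u ≟ v
      ... | yes refl = inj₁ (refl , trans (sym (updateAt-updates u c)) c′u)
      ... | no  u≢v  = inj₂ (u≢v , trans (sym (updateAt-minimal u v c u≢v)) c′u)

      keep : ∀ {u m} → m ≢ none → c u ≡ m → c′ u ≡ m
      keep {u} m≢none cu = trans (updateAt-minimal u v c (apart cu cv m≢none)) cu

      t-keep : ∀ {u m} → m ≢ none → c u ≡ m → t′ u ≡ t u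
      t-keep {u} m≢none cu = updateAt-minimal u v t (apart cu cv m≢none)

      support-new : Admissible c v s 𝔼 → ∃ λ u → v ~ u × (c′ u ≡ 𝕆 ⊎ (c′ u ≡ 𝕏 × t′ u ≢ v))
      support-new (u , v~u , inj₁ cu) = u , v~u , inj₁ (keep (λ ()) cu)
      -- The target of `u` lies in 𝔼 while `v` was uncoloured, so the edge to `v` is not the one
      -- that may be lowered.
      support-new (u , v~u , inj₂ cu) = u , v~u , inj₂ (keep (λ ()) cu , λ t′u≡v →
        apart (good .target cu .proj₂) cv (λ ()) (trans (sym (t-keep (λ ()) cu)) t′u≡v))

    add : Good c′ t′
    add .proper {a} {b} a~b eq with view a refl | view b (sym eq)
    ... | inj₁ (refl , _)  | inj₁ (refl , _)  = contradiction a~b ~-irrefl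
    ... | inj₁ (refl , k≡) | inj₂ (_ , cb)    = contradiction (trans cb (sym k≡)) (fresh a~b)
    ... | inj₂ (_ , ca)    | inj₁ (refl , k≡) = contradiction (trans ca (sym k≡)) (fresh (~-sym a~b))
    ... | inj₂ (_ , ca)    | inj₂ (_ , cb)    =
      trans (sym ca) (good .proper a~b (trans ca (sym cb)))
    add .partner {x} c′x with view x c′x
    ... | inj₁ (refl , refl) = let _ , y , v~y , cy , _ = admissible in y , v~y , keep (λ ()) cy
    ... | inj₂ (_ , cx)      = let y , x~y , cy = good .partner cx in y , x~y , keep (λ ()) cy
    add .partner-unique {x} {y} {y′} c′x x~y c′y x~y′ c′y′ with view x c′x | view y c′y | view y′ c′y′
    ... | inj₁ (refl , refl) | inj₂ (_ , cy) | inj₂ (_ , cy′) =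
      let _ , _ , _ , _ , unique , _ = admissible in trans (unique x~y cy) (sym (unique x~y′ cy′))
    ... | inj₂ (_ , cx) | inj₁ (refl , refl) | _ = contradiction cx (admissible (~-sym x~y))
    ... | inj₂ (_ , cx) | _ | inj₁ (refl , refl) = contradiction cx (admissible (~-sym x~y′))
    ... | inj₂ (_ , cx) | inj₂ (_ , cy) | inj₂ (_ , cy′) = good .partner-unique cx x~y cy x~y′ cy′
    add .source-unique {y} {x} {x′} c′y y~x c′x y~x′ c′x′ with view y c′y | view x c′x | view x′ c′x′
    ... | inj₁ (refl , refl) | inj₂ (_ , cx) | _ = contradiction cx (admissible y~x)
    ... | inj₂ (_ , cy) | inj₁ (refl , refl) | inj₁ (refl , _) = refl
    ... | inj₂ (_ , cy) | inj₁ (refl , refl) | inj₂ (_ , cx′) =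
      let _ , _ , _ , _ , unique , no-𝕏 = admissible
      in contradiction cx′ (no-𝕏 (subst (_~ x′) (unique (~-sym y~x) cy) y~x′))
    ... | inj₂ (_ , cy) | inj₂ (_ , cx) | inj₁ (refl , refl) =
      let _ , _ , _ , _ , unique , no-𝕏 = admissible
      in contradiction cx (no-𝕏 (subst (_~ x) (unique (~-sym y~x′) cy) y~x))
    ... | inj₂ (_ , cy) | inj₂ (_ , cx) | inj₂ (_ , cx′) = good .source-unique cy y~x cx y~x′ cx′
    add .target {x} c′x with view x c′x
    ... | inj₁ (refl , refl) = let (v~s , cs) , _ = admissible in
      subst (λ w → v ~ w × c′ w ≡ 𝔼) (sym (updateAt-updates v t)) (v~s , keep (λ ()) cs)
    ... | inj₂ (_ , cx) = let x~tx , ctx = good .target cx in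
      subst (λ w → x ~ w × c′ w ≡ 𝔼) (sym (t-keep (λ ()) cx)) (x~tx , keep (λ ()) ctx)
    add .support {w} c′w with view w c′w
    ... | inj₁ (refl , refl) = support-new admissible
    ... | inj₂ (_ , cw) with good .support cw
    ...   | u , w~u , inj₁ cu = u , w~u , inj₁ (keep (λ ()) cu)
    ...   | u , w~u , inj₂ (cu , tu≢w) =
      u , w~u , inj₂ (keep (λ ()) cu , λ t′u≡w → tu≢w (trans (sym (t-keep (λ ()) cu)) t′u≡w))

  -- Recolouring a matched pair

  module _ {c : Fin n → Colour} {t : Fin n → Fin n} {x y : Fin n} (good : Good c t)
           (cx : c x ≡ 𝕏) (cy : c y ≡ 𝕆) (x~y : x ~ y)
           (x-only : ∀ {w} → x ~ w → c w ≡ 𝔼 → w ≡ t x)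
           (y-only : ∀ {w} → y ~ w → c w ≢ none → c w ≢ 𝕀 → w ≡ x) where

    private
      c₀ : Fin n → Colour
      c₀ = updateAt (updateAt c x (const none)) y (const none)

      c₀-off : ∀ {u} → u ≢ x → u ≢ y → c₀ u ≡ c u
      c₀-off {u} u≢x u≢y = trans (updateAt-minimal u y _ u≢y) (updateAt-minimal u x c u≢x)

      c₀y : c₀ y ≡ none
      c₀y = updateAt-updates y _

      c₀x : c₀ x ≡ none
      c₀x = trans (updateAt-minimal x y _ (apart cx cy λ ())) (updateAt-updates x c)

      view : ∀ {u m} → m ≢ none → c₀ u ≡ m → u ≢ x × u ≢ y × c u ≡ m
      view m≢none c₀u = u≢x , u≢y , trans (sym (c₀-off u≢x u≢y)) c₀u
        where
        u≢x = apart c₀u c₀x m≢none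
        u≢y = apart c₀u c₀y m≢none

      keep : ∀ {u m} → m ≢ 𝕏 → m ≢ 𝕆 → c u ≡ m → c₀ u ≡ m
      keep m≢𝕏 m≢𝕆 cu = trans (c₀-off (apart cu cx m≢𝕏) (apart cu cy m≢𝕆)) cu

      ≢y : ∀ {w u m} → m ≢ none → m ≢ 𝕀 → w ≢ x → c w ≡ m → w ~ u → u ≢ y
      ≢y m≢none m≢𝕀 w≢x cw w~u refl =
        w≢x (y-only (~-sym w~u) (m≢none ∘ trans (sym cw)) (m≢𝕀 ∘ trans (sym cw)))

      -- Uncolouring `x` and `y` deprives no other vertex of its partner or support. By `y-only`, no
      -- other vertex of 𝕏 or 𝔼 is adjacent to `y`; by `x-only`, `x` is adjacent in 𝔼 to its target
      -- alone, which it does not support.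
      good₀ : Good c₀ t
      good₀ .proper {a} {b} a~b eq with c₀ a ≟ none
      ... | yes c₀a = c₀a
      ... | no  c₀a with _ , _ , ca ← view {a} c₀a refl | _ , _ , cb ← view {b} c₀a (sym eq) =
        trans (sym ca) (good .proper a~b (trans ca (sym cb)))
      good₀ .partner c₀z with z≢x , _ , cz ← view (λ ()) c₀z with z′ , z~z′ , cz′ ← good .partner cz =
        z′ , z~z′ , trans (c₀-off (apart cz′ cx λ ()) (≢y (λ ()) (λ ()) z≢x cz z~z′)) cz′
      good₀ .partner-unique c₀z z~a c₀a z~b c₀b
        with _ , _ , cz ← view (λ ()) c₀z | _ , _ , ca ← view (λ ()) c₀a | _ , _ , cb ← view (λ ()) c₀b =
        good .partner-unique cz z~a ca z~b cb
      good₀ .source-unique c₀z z~a c₀a z~b c₀b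
        with _ , _ , cz ← view (λ ()) c₀z | _ , _ , ca ← view (λ ()) c₀a | _ , _ , cb ← view (λ ()) c₀b =
        good .source-unique cz z~a ca z~b cb
      good₀ .target c₀z with _ , _ , cz ← view (λ ()) c₀z with z~tz , ctz ← good .target cz =
        z~tz , keep (λ ()) (λ ()) ctz
      good₀ .support {w} c₀w with view (λ ()) c₀w
      ... | w≢x , w≢y , cw with good .support cw
      ...   | u , w~u , inj₁ cu = u , w~u ,
        inj₁ (trans (c₀-off (apart cu cx λ ()) (≢y (λ ()) (λ ()) w≢x cw w~u)) cu)
      ...   | u , w~u , inj₂ (cu , tu≢w) =
        u , w~u , inj₂ (trans (c₀-off u≢x (apart cu cy λ ())) cu , tu≢w)
        where
        u≢x : u ≢ x
        u≢x refl = tu≢w (sym (x-only (~-sym w~u) cw))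

      -- The only 𝕆-neighbour of `x` was `y`, now uncoloured, so `x` can take 𝕆. Its new target is a
      -- placeholder.
      good₁ : Good (updateAt c₀ x (const 𝕆)) (updateAt t x (const x))
      good₁ = add 𝕆 x good₀ c₀x
        (λ x~u c₀u → let _ , _ , cu = view (λ ()) c₀u in
          case trans (sym cx) (good .proper x~u (trans cx (sym cu))) of λ ())
        (λ x~u c₀u → let _ , u≢y , cu = view (λ ()) c₀u in
          u≢y (good .partner-unique cx x~u cu x~y cy))

      c₁ : Fin n → Colour
      c₁ = updateAt c₀ x (const 𝕆)

      c₁x : c₁ x ≡ 𝕆
      c₁x = updateAt-updates x c₀

    -- Turns the path t x (𝔼), x (𝕏), y (𝕆) into 𝔼, 𝕆, 𝔼, freeing the end y for a new 𝕆-neighbour.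
    flip : ∃₂ λ c′ t′ → Good c′ t′ × c′ x ≡ 𝕆 × c′ y ≡ 𝔼 × (∀ {u} → u ≢ x → u ≢ y → c′ u ≡ c u)
    flip = _ , _
      , add 𝔼 y good₁ (trans (updateAt-minimal y x c₀ (apart cy cx λ ())) c₀y)
          (x , ~-sym x~y , inj₁ c₁x) fresh
      , trans (updateAt-minimal x y c₁ (apart cx cy λ ())) c₁x
      , updateAt-updates y c₁
      , λ {u} u≢x u≢y → trans (updateAt-minimal u y c₁ u≢y)
          (trans (updateAt-minimal u x c₀ u≢x) (c₀-off u≢x u≢y))
      where
      fresh : ∀ {w} → y ~ w → c₁ w ≢ 𝔼
      fresh {w} y~w c₁w
        with w≢x ← apart {c₁} c₁w c₁x (λ ())
        with _ , _ , cw ← view {w} (λ ()) (trans (sym (updateAt-minimal w x c₀ w≢x)) c₁w) =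
        ≢y (λ ()) (λ ()) w≢x cw (~-sym y~w) refl

  -- Colouring one more vertex

  record Step (c : Fin n → Colour) (v : Fin n) : Set where
    field
      {c′}   : Fin n → Colour
      {t′}   : Fin n → Fin n
      good   : Good c′ t′
      new    : c′ v ≢ none
      old    : ∀ {u} → c u ≢ none → c′ u ≢ none
      -- Other colours may change under `flip`, but 𝕀 has to keep dominating the core.
      old-𝕀  : ∀ {u} → c u ≡ 𝕀 → c′ u ≡ 𝕀
      inside : ∀ {u} → c′ u ≢ none → u ≡ v ⊎ c u ≢ none

  step : ∀ {c t v} k s → Good c t → c v ≡ none → Admissible c v s k →
    (∀ {u} → v ~ u → c u ≢ k) → Step c v
  step {c} {v = v} k s good cv admissible fresh = record
    { good   = add k s good cv admissible fresh
    ; new    = λ c′v → k≢none k admissible (trans (sym (updateAt-updates v c)) c′v)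
    ; old    = λ cu → cu ∘ trans (sym (off λ { refl → cu cv }))
    ; old-𝕀  = λ cu → trans (off (apart cu cv λ ())) cu
    ; inside = inside
    }
    where
    k≢none : ∀ k → Admissible c v s k → k ≢ none
    k≢none none ()

    off : ∀ {u} → u ≢ v → updateAt c v (const k) u ≡ c u
    off {u} = updateAt-minimal u v c

    inside : ∀ {u} → updateAt c v (const k) u ≢ none → u ≡ v ⊎ c u ≢ none
    inside {u} c′u with u ≟ v
    ... | yes u≡v = inj₁ u≡v
    ... | no  u≢v = inj₂ (c′u ∘ trans (off u≢v))

  neighbour? : (c : Fin n → Colour) (v : Fin n) (k : Colour) → Dec (∃ λ u → v ~ u × c u ≡ k)
  neighbour? c v k = any? λ u → v ~? u ×-dec c u ≟ k

  coloured : {c : Fin n → Colour} {u : Fin n} {k : Colour} → c u ≡ k → k ≢ none → c u ≢ none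
  coloured cu k≢none c0 = k≢none (trans (sym cu) c0)

  -- If 𝕀 is blocked, at most one coloured neighbour lies outside 𝕀. If that one is in 𝕆 or 𝕏, it
  -- supports `v` in 𝔼 and leaves no 𝔼-neighbour; otherwise 𝕆 is free.
  peel-step : ∀ {c t v} → Good c t → c v ≡ none → AtMost 2 (λ u → v ~ u × c u ≢ none) → Step c v
  peel-step {c} {v = v} good cv few with neighbour? c v 𝕀
  ... | no  no-𝕀 = step 𝕀 v good cv tt (λ v~u cu → no-𝕀 (_ , v~u , cu))
  ... | yes (i , v~i , ci) with any? (λ u → v ~? u ×-dec (c u ≟ 𝕆 ⊎-dec c u ≟ 𝕏))
  ...   | no no-odd = step 𝕆 v good cv
    (λ v~u cu → no-odd (_ , v~u , inj₂ cu)) (λ v~u cu → no-odd (_ , v~u , inj₁ cu))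
  ...   | yes (u , v~u , odd) = step 𝔼 v good cv (u , v~u , odd) (λ v~w cw →
    few i (v~i , coloured {c} ci λ ()) u ((v~u , u≢none odd) , u≢i odd) _
      (((v~w , coloured {c} cw λ ()) , apart {c} cw ci λ ()) , w≢u cw odd))
    where
    u≢none : c u ≡ 𝕆 ⊎ c u ≡ 𝕏 → c u ≢ none
    u≢none (inj₁ cu) = coloured {c} cu λ ()
    u≢none (inj₂ cu) = coloured {c} cu λ ()
    u≢i : c u ≡ 𝕆 ⊎ c u ≡ 𝕏 → u ≢ i
    u≢i (inj₁ cu) = apart {c} cu ci λ ()
    u≢i (inj₂ cu) = apart {c} cu ci λ ()
    w≢u : ∀ {w} → c w ≡ 𝔼 → c u ≡ 𝕆 ⊎ c u ≡ 𝕏 → w ≢ u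
    w≢u cw (inj₁ cu) = apart {c} cw cu λ ()
    w≢u cw (inj₂ cu) = apart {c} cw cu λ ()

  -- The colours 𝕆 and then 𝔼 are tried. If both are blocked, `v` has one neighbour `w` in 𝔼 and one
  -- neighbour `y` in 𝕆: `v` joins 𝕏 if `y` is unmatched, and otherwise `flip` moves `y` to 𝔼 so
  -- that `v` can take 𝕆.
  core-step : ∀ (S : Fin n → Bool) {c t v} → Good c t → c v ≡ none → S v ≡ true →
    (∀ {u} → c u ≢ none → S u ≡ true) →
    (∀ {u} → S u ≡ true → c u ≢ 𝕀 → AtMost 2 (λ w → u ~ w × S w ≡ true × c w ≢ 𝕀)) →
    Step c v
  core-step S {c} {t} {v} good cv Sv inside few = decide (neighbour? c v 𝔼) (neighbour? c v 𝕆)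
    where
    Neighbour : Fin n → Fin n → Set
    Neighbour u w = u ~ w × S w ≡ true × c w ≢ 𝕀

    nb : ∀ {u w k} → u ~ w → c w ≡ k → k ≢ none → k ≢ 𝕀 → Neighbour u w
    nb u~w cw k≢none k≢𝕀 = u~w , inside (coloured {c} cw k≢none) , k≢𝕀 ∘ trans (sym cw)

    nb-v : ∀ {u} → v ~ u → Neighbour u v
    nb-v v~u = ~-sym v~u , Sv , λ cv′ → case trans (sym cv) cv′ of λ ()

    few-at : ∀ {u k} → c u ≡ k → k ≢ none → k ≢ 𝕀 → AtMost 2 (Neighbour u)
    few-at cu k≢none k≢𝕀 = few (inside (coloured {c} cu k≢none)) (k≢𝕀 ∘ trans (sym cu))

    -- The partner and the target of an 𝕏-vertex already are its two neighbours in `S` outside 𝕀,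
    -- which leaves no place for `v`.
    no-𝕏 : ∀ {x} → v ~ x → c x ≢ 𝕏
    no-𝕏 {x} v~x cx =
      let y , x~y , cy = good .partner cx
          x~tx , ctx = good .target cx
      in few-at cx (λ ()) (λ ()) v (nb-v v~x)
           y (nb x~y cy (λ ()) (λ ()) , apart {c} cy cv λ ())
           (t x) ((nb x~tx ctx (λ ()) (λ ()) , apart {c} ctx cv λ ()) , apart {c} ctx cy λ ())

    decide : Dec (∃ λ w → v ~ w × c w ≡ 𝔼) → Dec (∃ λ y → v ~ y × c y ≡ 𝕆) → Step c v
    decide _ (no no-𝕆) = step 𝕆 v good cv no-𝕏 (λ v~u cu → no-𝕆 (_ , v~u , cu))
    decide (no no-𝔼) (yes (y , v~y , cy)) =
      step 𝔼 v good cv (y , v~y , inj₁ cy) (λ v~u cu → no-𝔼 (_ , v~u , cu))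
    decide (yes (w , v~w , cw)) (yes (y , v~y , cy)) = cases (neighbour? c y 𝕏)
      where
      unique : ∀ {y′} → v ~ y′ → c y′ ≡ 𝕆 → y′ ≡ y
      unique {y′} v~y′ cy′ with y′ ≟ y
      ... | yes y′≡y = y′≡y
      ... | no  y′≢y = ⊥-elim
        (few Sv (λ cv′ → case trans (sym cv) cv′ of λ ()) w (nb v~w cw (λ ()) λ ())
          y (nb v~y cy (λ ()) (λ ()) , apart {c} cy cw λ ())
          y′ ((nb v~y′ cy′ (λ ()) (λ ()) , apart {c} cy′ cw λ ()) , y′≢y))

      cases : Dec (∃ λ x → y ~ x × c x ≡ 𝕏) → Step c v
      cases (no no-source) = step 𝕏 w good cv
        ((v~w , cw) , y , v~y , cy , unique , λ y~x cx → no-source (_ , y~x , cx)) no-𝕏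
      -- Outside 𝕀, the two neighbours of `x` in `S` are `y` and `t x`, and those of `y` are `v` and
      -- `x`; this gives both hypotheses of `flip`.
      cases (yes (x , y~x , cx)) with flip good cx cy (~-sym y~x) x-only y-only
        where
        x-only : ∀ {z} → x ~ z → c z ≡ 𝔼 → z ≡ t x
        x-only {z} x~z cz with z ≟ t x | good .target cx
        ... | yes z≡tx | _ = z≡tx
        ... | no  z≢tx | x~tx , ctx = ⊥-elim
          (few-at cx (λ ()) (λ ()) y (nb (~-sym y~x) cy (λ ()) λ ())
            (t x) (nb x~tx ctx (λ ()) (λ ()) , apart {c} ctx cy λ ())
            z ((nb x~z cz (λ ()) (λ ()) , apart {c} cz cy λ ()) , z≢tx))

        y-only : ∀ {z} → y ~ z → c z ≢ none → c z ≢ 𝕀 → z ≡ x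
        y-only {z} y~z cz≢none cz≢𝕀 with z ≟ x
        ... | yes z≡x = z≡x
        ... | no  z≢x = ⊥-elim
          (few-at cy (λ ()) (λ ()) v (nb-v v~y)
            x (nb y~x cx (λ ()) (λ ()) , apart {c} cx cv λ ())
            z (((y~z , inside cz≢none , cz≢𝕀) , λ { refl → cz≢none cv }) , z≢x))
      ... | c₁ , t₁ , good₁ , c₁x , c₁y , off = record
        { good   = good′
        ; new    = new
        ; old    = λ cu → old (old₁ cu)
        ; old-𝕀  = λ cu → old-𝕀 (trans (off (apart {c} cu cx λ ()) (apart {c} cu cy λ ())) cu)
        ; inside = λ cu → Sum.map₂ inside₁ (inside′ cu)
        }
        where
        off-v : c₁ v ≡ none
        off-v = trans (off (apart {c} cv cx λ ()) (apart {c} cv cy λ ())) cv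

        old₁ : ∀ {u} → c u ≢ none → c₁ u ≢ none
        old₁ {u} cu c₁u with u ≟ x | u ≟ y
        ... | yes refl | _ = case trans (sym c₁u) c₁x of λ ()
        ... | _ | yes refl = case trans (sym c₁u) c₁y of λ ()
        ... | no u≢x | no u≢y = cu (trans (sym (off u≢x u≢y)) c₁u)

        inside₁ : ∀ {u} → c₁ u ≢ none → c u ≢ none
        inside₁ {u} c₁u cu = c₁u (trans (off (apart {c} cu cx λ ()) (apart {c} cu cy λ ())) cu)

        -- The flip moves the only 𝕆-neighbour `y` of `v` to 𝔼. It creates a new 𝕆-vertex only at
        -- `x`, which was in 𝕏 and so is not adjacent to `v`.
        no-odd : ∀ {u} → v ~ u → c₁ u ≢ 𝕏 × c₁ u ≢ 𝕆
        no-odd {u} v~u with u ≟ x | u ≟ y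
        ... | yes refl | _ = contradiction cx (no-𝕏 v~u)
        ... | _ | yes refl = (λ c₁u → case trans (sym c₁u) c₁y of λ ()) , (λ c₁u → case trans (sym c₁u) c₁y of λ ())
        ... | no u≢x | no u≢y = (λ c₁u → no-𝕏 v~u (trans (sym (off u≢x u≢y)) c₁u)) ,
          (λ c₁u → u≢y (unique v~u (trans (sym (off u≢x u≢y)) c₁u)))

        open Step (step 𝕆 v good₁ off-v (proj₁ ∘ no-odd) (proj₂ ∘ no-odd))
          renaming (good to good′; inside to inside′)

  -- Colouring the core and the whole graph

  record Colouring (S : Fin n → Bool) : Set where
    field
      {c}    : Fin n → Colour
      {t}    : Fin n → Fin n
      good   : Good c t
      inside : ∀ {u} → c u ≢ none → S u ≡ true
      total  : ∀ {u} → S u ≡ true → c u ≢ none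

  -- One pass over the vertices suffices, because an improvement at one vertex preserves what was
  -- achieved at others.
  sweep : {X : Set} {Done : X → Fin n → Set} →
    (∀ x v → ∃ λ x′ → Done x′ v × (∀ {u} → Done x u → Done x′ u)) → X → ∃ λ x → ∀ v → Done x v
  sweep {X} {Done} improve x₀ = let x , done = go (allFin n) in x , λ v → done (∈-allFin v)
    where
    go : (vs : List (Fin n)) → ∃ λ x → ∀ {v} → v ∈ vs → Done x v
    go []       = x₀ , λ ()
    go (v ∷ vs) =
      let x , done = go vs
          x′ , done-v , kept = improve x v
      in x′ , λ { (here refl) → done-v ; (there u∈vs) → kept (done u∈vs) }

  module _ (S : Fin n → Bool) (few : ∀ v → S v ≡ true → deg G S v ≤ 3) where

    private
      Dominated : (Fin n → Colour) → Fin n → Set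
      Dominated c v = c v ≡ 𝕀 ⊎ ∃ λ u → v ~ u × c u ≡ 𝕀

      Independent : Set
      Independent = ∃₂ λ c t → Good c t × (∀ {u} → c u ≢ none → S u ≡ true) × (∀ {u} → c u ≢ none → c u ≡ 𝕀)

      -- Greedy choice of a maximal independent set, with maximality expressed as domination of `S`.
      maximal : Σ Independent λ (c , _) → ∀ v → S v ≡ true → Dominated c v
      maximal = sweep improve ((const none) , (λ v → v) , empty , (λ c≢ → contradiction refl c≢) , (λ c≢ → contradiction refl c≢))
        where
        empty : Good (const none) (λ v → v)
        empty = record
          { proper = λ _ _ → refl ; partner = λ () ; partner-unique = λ () ; source-unique = λ ()
          ; target = λ () ; support = λ () }

        improve : ∀ (x : Independent) v → Σ Independent λ x′ → (S v ≡ true → Dominated (proj₁ x′) v) ×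
          (∀ {u} → (S u ≡ true → Dominated (proj₁ x) u) → S u ≡ true → Dominated (proj₁ x′) u)
        improve x@(c , t , good , inside , all-𝕀) v with S v Bool.≟ true | c v ≟ none | neighbour? c v 𝕀
        ... | no ¬Sv | _      | _     = x , (λ Sv → contradiction Sv ¬Sv) , λ d → d
        ... | yes Sv | no cv  | _     = x , (λ _ → inj₁ (all-𝕀 cv)) , λ d → d
        ... | yes Sv | yes cv | yes u = x , (λ _ → inj₂ u) , λ d → d
        ... | yes Sv | yes cv | no no-𝕀 =
          (c′ , _ , add 𝕀 v good cv tt (λ v~u cu → no-𝕀 (_ , v~u , cu)) , inside′ , all-𝕀′) ,
          (λ _ → inj₁ c′v) ,
          λ d Su → Sum.map keep (λ (w , u~w , cw) → w , u~w , keep cw) (d Su)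
          where
          c′ = updateAt c v (const 𝕀)

          c′v : c′ v ≡ 𝕀
          c′v = updateAt-updates v c

          keep : ∀ {u} → c u ≡ 𝕀 → c′ u ≡ 𝕀
          keep {u} cu = trans (updateAt-minimal u v c (apart cu cv λ ())) cu

          inside′ : ∀ {u} → c′ u ≢ none → S u ≡ true
          inside′ {u} c′u with u ≟ v
          ... | yes refl = Sv
          ... | no  u≢v  = inside (c′u ∘ trans (updateAt-minimal u v c u≢v))

          all-𝕀′ : ∀ {u} → c′ u ≢ none → c′ u ≡ 𝕀
          all-𝕀′ {u} c′u with u ≟ v
          ... | yes refl = c′v
          ... | no  u≢v  = keep (all-𝕀 (c′u ∘ trans (updateAt-minimal u v c u≢v)))

      Partial : Set
      Partial = ∃₂ λ c t → Good c t × (∀ {u} → c u ≢ none → S u ≡ true) × (∀ {u} → S u ≡ true → Dominated c u)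

      complete : Partial → Σ Partial λ (c , _) → ∀ v → S v ≡ true → c v ≢ none
      complete = sweep improve
        where
        improve : ∀ (x : Partial) v → Σ Partial λ x′ → (S v ≡ true → proj₁ x′ v ≢ none) ×
          (∀ {u} → (S u ≡ true → proj₁ x u ≢ none) → S u ≡ true → proj₁ x′ u ≢ none)
        improve x@(c , t , good , inside , dom) v with S v Bool.≟ true | c v ≟ none
        ... | no ¬Sv | _     = x , (λ Sv → contradiction Sv ¬Sv) , λ d → d
        ... | yes Sv | no cv = x , (λ _ → cv) , λ d → d
        ... | yes Sv | yes cv =
          (s.c′ , s.t′ , s.good , inside′ , λ Su → Sum.map s.old-𝕀 (λ (w , u~w , cw) → w , u~w , s.old-𝕀 cw) (dom Su)) ,
          (λ _ → s.new) , λ d Su → s.old (d Su)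
          where
          few-neighbours : ∀ {u} → S u ≡ true → c u ≢ 𝕀 → AtMost 2 (λ w → u ~ w × S w ≡ true × c w ≢ 𝕀)
          few-neighbours {u} Su cu with dom Su
          ... | inj₁ cu≡𝕀 = contradiction cu≡𝕀 cu
          -- Of the at most three neighbours of `u` in `S`, the vertex `i` is in 𝕀, so at most two
          -- lie outside 𝕀.
          ... | inj₂ (i , u~i , ci) =
            AtMost-⊆ 2 (λ (u~w , Sw , cw) → cong₂ _∧_ u~w Sw , λ { refl → cw ci })
              (count⇒AtMost 3 (few u Su) i (cong₂ _∧_ u~i (inside (coloured {c} ci λ ()))))

          module s = Step (core-step S good cv Sv inside few-neighbours)

          inside′ : ∀ {u} → s.c′ u ≢ none → S u ≡ true
          inside′ c′u with s.inside c′u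
          ... | inj₁ refl = Sv
          ... | inj₂ cu   = inside cu

    core : Colouring S
    core with maximal
    ... | (_ , _ , good , inside , _) , dom with complete (_ , _ , good , inside , λ {u} → dom u)
    ...   | (_ , _ , good′ , inside′ , _) , total =
      record { good = good′ ; inside = inside′ ; total = λ {u} → total u }

  -- Induction on a bound for the size of `S`. A vertex of degree at most 2 within `S` is removed
  -- and coloured last; if there is none, all degrees are at least 3 and `core-cubic` applies.
  peel : mad≤3 G → ∀ k S → count S ≤ k → Colouring S
  peel mad k S S≤k with any? (λ v → S v Bool.≟ true ×-dec deg G S v ≤? 2)
  ... | no no-low = core S (core-cubic G mad S λ v Sv → ≰⇒> λ low → no-low (v , Sv , low))
  peel mad zero    S S≤k | yes (v , Sv , low) with () ← subst (_≤ 0) (count-∖ S Sv) S≤k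
  peel mad (suc k) S S≤k | yes (v , Sv , low) with s≤s S∖v≤k ← subst (_≤ suc k) (count-∖ S Sv) S≤k =
    record { good = s.good ; inside = inside ; total = total }
    where
    module r = Colouring (peel mad k (S ∖ v) S∖v≤k)

    cv : r.c v ≡ none
    cv with r.c v ≟ none
    ... | yes cv = cv
    ... | no  cv = case trans (sym (∖-self S v)) (r.inside cv) of λ ()

    module s = Step (peel-step r.good cv (AtMost-⊆ 2
      (λ (v~u , cu) → cong₂ _∧_ v~u (∧-trueˡ (r.inside cu))) (count⇒AtMost 2 low)))

    inside : ∀ {u} → s.c′ u ≢ none → S u ≡ true
    inside c′u with s.inside c′u
    ... | inj₁ refl = Sv
    ... | inj₂ cu   = ∧-trueˡ (r.inside cu)

    total : ∀ {u} → S u ≡ true → s.c′ u ≢ none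
    total {u} Su with u ≟ v
    ... | yes refl = s.new
    ... | no  u≢v  = s.old (r.total (trans (sym (∖-≢ S u≢v)) Su))

  -- From a good colouring to a labelling

  module _ {c : Fin n → Colour} {t : Fin n → Fin n} (good : Good c t) (total : ∀ u → c u ≢ none) where

    private
      𝔼? : Colour → Bool
      𝔼? 𝔼 = true
      𝔼? _ = false

      𝔼-neighbours : Fin n → Fin n → Bool
      𝔼-neighbours v u = Adj G v u ∧ 𝔼? (c u)

      -- Here `z` is the label of the edge from `x` to its target and `e` that of the matching edge
      -- `xy`. The two sides are the resulting numbers of ones at `x` and `y`, vertex labels
      -- included.
      Separating : Fin n → Bool × Bool → Set
      Separating x (z , e) = c x ≡ 𝕏 → ∀ {y} → x ~ y → c y ≡ 𝕆 →
        roundOdd (bit e + (bit z + count (𝔼-neighbours x ∖ t x))) ≢ roundOdd (bit e + count (𝔼-neighbours y))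

      -- abstract keeps case splits on c x from unfolding the labels chosen here.
      abstract
        separation : ∀ x → ∃ (Separating x)
        separation x with c x ≟ 𝕏
        ... | no cx = (true , true) , λ cx′ → contradiction cx′ cx
        ... | yes cx with good .partner cx
        -- First `z` makes the numbers of ones on the edges to 𝔼 differ, then `e` keeps them
        -- different after rounding to odd numbers.
        ...   | y , x~y , cy with z , z≢ ← shift-≢ (count (𝔼-neighbours x ∖ t x)) (count (𝔼-neighbours y))
                             with e , e≢ ← shift-roundOdd z≢ =
          (z , e) , λ _ x~y′ cy′ → subst (λ w → _ ≢ roundOdd (bit e + count (𝔼-neighbours w)))
            (good .partner-unique cx x~y cy x~y′ cy′) e≢

      target-label partner-label : Fin n → Bool
      target-label x  = proj₁ (proj₁ (separation x))
      partner-label x = proj₂ (proj₁ (separation x))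

      -- Each kind of edge that can be labelled 1 is listed in one direction only; the disjunction
      -- in `edge-label` makes the labelling symmetric.
      half : Colour → Colour → Fin n → Fin n → Bool
      half 𝕆 𝔼 _ _ = true
      half 𝕏 𝔼 x w = if ⌊ w ≟ t x ⌋ then target-label x else true
      half 𝕏 𝕆 x _ = partner-label x
      half _ _ _ _ = false

      edge-label : Fin n → Fin n → Bool
      edge-label u v = half (c u) (c v) u v ∨ half (c v) (c u) v u

      ones : Fin n → Fin n → Bool
      ones v u = Adj G v u ∧ edge-label v u

      vertex-label : Colour → ℕ → Bool
      vertex-label 𝔼 m = not (even? m)
      vertex-label 𝕆 m = even? m
      vertex-label 𝕏 m = even? m
      vertex-label _ m = false

      total-ones : Fin n → ℕ
      total-ones v = bit (vertex-label (c v) (count (ones v))) + count (ones v)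

      -- All edges from `y` to 𝔼 are labelled 1. The only other edge that can be is `xy`, since `x`
      -- is the only 𝕏-neighbour of `y`.
      count-ones-𝕆 : ∀ {x y} → c y ≡ 𝕆 → y ~ x → c x ≡ 𝕏 →
        count (ones y) ≡ bit (partner-label x) + count (𝔼-neighbours y)
      count-ones-𝕆 {x} {y} cy y~x cx =
        trans (count-at x at-x off) (cong (λ b → bit b + count (𝔼-neighbours y)) ones-x)
        where
        at-x : 𝔼-neighbours y x ≡ false
        at-x rewrite cx = ∧-zeroʳ _
        ones-x : ones y x ≡ partner-label x
        ones-x rewrite y~x | cy | cx = refl
        off : ∀ u → u ≢ x → ones y u ≡ 𝔼-neighbours y u
        off u u≢x with Adj G y u in y~u
        ... | false = refl
        ... | true with c u in cu
        ...   | none = contradiction cu (total u)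
        ...   | 𝕀 rewrite cy = refl
        ...   | 𝔼 rewrite cy = refl
        ...   | 𝕆 rewrite cy = refl
        ...   | 𝕏 = contradiction (good .source-unique cy y~u cu y~x cx) u≢x

      count-ones-𝕏 : ∀ {x y} → c x ≡ 𝕏 → x ~ y → c y ≡ 𝕆 →
        count (ones x) ≡ bit (partner-label x) + (bit (target-label x) + count (𝔼-neighbours x ∖ t x))
      count-ones-𝕏 {x} {y} cx x~y cy = begin
        count (ones x)
          ≡⟨ count-at y at-y off-y ⟩
        bit (ones x y) + count middle
          ≡⟨ cong₂ (λ b m → bit b + m) ones-y (count-at (t x) (∖-self (𝔼-neighbours x) (t x)) off-tx) ⟩
        bit (partner-label x) + (bit (middle (t x)) + count (𝔼-neighbours x ∖ t x))
          ≡⟨ cong (λ b → bit (partner-label x) + (bit b + count (𝔼-neighbours x ∖ t x))) at-tx ⟩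
        bit (partner-label x) + (bit (target-label x) + count (𝔼-neighbours x ∖ t x)) ∎
        where
        x~tx = good .target cx .proj₁
        ctx  = good .target cx .proj₂

        -- This is `ones x` without the edge to `y`. The two exceptional edges, to `y` and to `t x`,
        -- are split off one at a time.
        middle : Fin n → Bool
        middle u = if ⌊ u ≟ t x ⌋ then target-label x else 𝔼-neighbours x u

        at-y : middle y ≡ false
        at-y rewrite ≟-≢ (apart {c} cy ctx λ ()) | cy = ∧-zeroʳ _
        ones-y : ones x y ≡ partner-label x
        ones-y rewrite x~y | cx | cy = ∨-identityʳ _
        at-tx : middle (t x) ≡ target-label x
        at-tx rewrite ≟-refl (t x) = refl
        off-tx : ∀ u → u ≢ t x → middle u ≡ (𝔼-neighbours x ∖ t x) u
        off-tx u u≢tx rewrite ≟-≢ u≢tx = sym (∧-identityʳ _)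
        off-y : ∀ u → u ≢ y → ones x u ≡ middle u
        off-y u u≢y with u ≟ t x
        ... | yes refl rewrite x~tx | cx | ctx | ≟-refl (t x) = ∨-identityʳ _
        ... | no u≢tx with Adj G x u in x~u
        ...   | false = refl
        ...   | true with c u in cu
        ...     | none = contradiction cu (total u)
        ...     | 𝕀 rewrite cx = refl
        ...     | 𝔼 rewrite cx | ≟-≢ u≢tx = refl
        ...     | 𝕆 = contradiction (good .partner-unique cx x~u cu x~y cy) u≢y
        ...     | 𝕏 rewrite cx = refl

      ones-𝕀 : ∀ {v} → c v ≡ 𝕀 → count (ones v) ≡ 0
      ones-𝕀 {v} cv = count-false unlabelled
        where
        unlabelled : ∀ u → ones v u ≡ false
        unlabelled u with c u
        ... | none rewrite cv = ∧-zeroʳ _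
        ... | 𝕀 rewrite cv = ∧-zeroʳ _
        ... | 𝔼 rewrite cv = ∧-zeroʳ _
        ... | 𝕆 rewrite cv = ∧-zeroʳ _
        ... | 𝕏 rewrite cv = ∧-zeroʳ _

      -- The support edge is never lowered. Hence the even number of ones on 𝔼 is not 0, the value
      -- on 𝕀.
      ones-𝔼 : ∀ {w} → c w ≡ 𝔼 → count (ones w) ≢ 0
      ones-𝔼 {w} cw none-labelled with good .support cw
      ... | u , w~u , col = case trans (sym none-labelled) (count-∖ (ones w) (labelled col)) of λ ()
        where
        labelled : c u ≡ 𝕆 ⊎ (c u ≡ 𝕏 × t u ≢ w) → ones w u ≡ true
        labelled (inj₁ cu) rewrite w~u | cw | cu = refl
        labelled (inj₂ (cu , tu≢w)) rewrite w~u | cw | cu | ≟-≢ (tu≢w ∘ sym) = refl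

      class-total-ones : ∀ v → class (total-ones v) ≡ c v ⊎ (class (total-ones v) ≡ 𝕆 × c v ≡ 𝕏)
      class-total-ones v = split (c v) refl
        where
        m = count (ones v)

        split : ∀ k → c v ≡ k → let s = class (bit (vertex-label k m) + m) in s ≡ k ⊎ (s ≡ 𝕆 × k ≡ 𝕏)
        split none cv = contradiction cv (total v)
        split 𝕀 cv = inj₁ (cong class (ones-𝕀 cv))
        split 𝔼 cv = inj₁ (class-even (roundEven m) (roundEven-even m)
          (ones-𝔼 cv ∘ ℕ.m+n≡0⇒n≡0 (bit (not (even? m)))))
        split 𝕆 cv = inj₁ (class-odd (roundOdd m) (roundOdd-odd m))
        split 𝕏 cv = inj₂ (class-odd (roundOdd m) (roundOdd-odd m) , refl)

      total-ones-𝕏𝕆 : ∀ {x y} → c x ≡ 𝕏 → c y ≡ 𝕆 → x ~ y → total-ones x ≢ total-ones y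
      total-ones-𝕏𝕆 {x} {y} cx cy x~y eq = proj₂ (separation x) cx x~y cy (begin
        roundOdd (bit (partner-label x) + (bit (target-label x) + count (𝔼-neighbours x ∖ t x)))
          ≡⟨ cong roundOdd (sym (count-ones-𝕏 cx x~y cy)) ⟩
        roundOdd (count (ones x))  ≡⟨ cong (λ k → bit (vertex-label k (count (ones x))) + count (ones x)) (sym cx) ⟩
        total-ones x               ≡⟨ eq ⟩
        total-ones y               ≡⟨ cong (λ k → bit (vertex-label k (count (ones y))) + count (ones y)) cy ⟩
        roundOdd (count (ones y))  ≡⟨ cong roundOdd (count-ones-𝕆 cy (~-sym x~y) cx) ⟩
        roundOdd (bit (partner-label x) + count (𝔼-neighbours y)) ∎)

      -- Equal numbers of ones give equal classes. Then both ends have the same colour, which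
      -- `proper` excludes, or the edge joins 𝕏 and 𝕆, where `separation` applies.
      total-ones-proper : ∀ {u v} → u ~ v → total-ones u ≢ total-ones v
      total-ones-proper {u} {v} u~v eq with class-total-ones u | class-total-ones v
      ... | inj₁ su | inj₁ sv =
        total u (good .proper u~v (trans (sym su) (trans (cong class eq) sv)))
      ... | inj₁ su | inj₂ (sv , cv) =
        total-ones-𝕏𝕆 cv (trans (sym su) (trans (cong class eq) sv)) (~-sym u~v) (sym eq)
      ... | inj₂ (su , cu) | inj₁ sv =
        total-ones-𝕏𝕆 cu (trans (sym sv) (trans (cong class (sym eq)) su)) u~v eq
      ... | inj₂ (_ , cu) | inj₂ (_ , cv) = total u (good .proper u~v (trans cu (sym cv)))

    labelling : TotalLabelling G 2
    labelling = record
      { vl      = λ v → fromBool (vertex-label (c v) (count (ones v)))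
      ; el      = λ u v → fromBool (edge-label u v)
      ; el-symm = λ u v → cong fromBool (∨-comm (half (c u) (c v) u v) _)
      }

    labelling-proper : MultisetProper labelling
    -- The multiplicity of the label `suc zero` alone distinguishes the two multisets.
    labelling-proper u v u~v μ≡ =
      total-ones-proper u~v (trans (sym (μ-total-ones u)) (trans (μ≡ (suc zero)) (μ-total-ones v)))
      where
      μ-total-ones : ∀ w → μ labelling w (suc zero) ≡ total-ones w
      μ-total-ones w = cong₂ (λ b m → bit b + m) (≟-fromBool _)
        (count-cong λ u → cong (Adj G w u ∧_) (≟-fromBool (edge-label w u)))

theorem1p4 : ∀ (n : ℕ) (G : Graph n) → mad≤3 G →
    Σ (TotalLabelling G 2) (λ ℓ → MultisetProper ℓ)
theorem1p4 n G mad = labelling G good (λ u → total refl) , labelling-proper G good (λ u → total refl)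
  where open Colouring (peel G mad (count {n} (const true)) (const true) ≤-refl)
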